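{- Let $n>2$ and $t>2$ be two positive integers. Then \[\varphi(C_n\boxdot S_t)=\begin{cases} 2n, & \text{if } n\leq \left\lfloor\frac {t+3}2\right\rfloor,\\ t+3, & \text{if } \left\lfloor\frac {t+3}2\right\rfloor< n \leq t+2,\\ n, & \text{if } t+3\leq n\leq 2t+4,\\ 2t+5, & \text{otherwise}. \end{cases}\]
   Context: All graphs are finite and simple. $C_n$ denotes the cycle with $n$ vertices and $S_t$ denotes the star with $t$ leaves (so it has $t+1$ vertices). The subdivision graph $S(G)$ of a graph $G$ is obtained by inserting one new vertex into every edge of $G$. For graphs $G$ and $H$, with $V(G)=\{u_0,\ldots,u_{m-1}\}$, the subdivision-vertex neighbourhood corona (SVN corona) $G\boxdot H$ is the graph obtained from $S(G)$ by adding $m$ vertex-disjoint copies of $H$ (one for each $u_i$) and joining, for each $i$, every vertex of $N_{S(G)}(u_i)$ (the neighbourhood of $u_i$ in $S(G)$) to every vertex of the copy of $H$ associated with $u_i$. A $b$-chromatic coloring of a graph with $k$ colors is a proper coloring with colors $0,\ldots,k-1$ such that, for each color $i$, there is a vertex (a $b$-vertex) of color $i$ having, for each color $j\neq i$, a neighbour of color $j$. The $b$-chromatic number $\varphi(G)$ is the maximum $k$ for which $G$ has a $b$-chromatic coloring with $k$ colors. -}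

module Defs where

open import Data.Empty using (⊥; ⊥-elim)
open import Data.Fin as Fin using (Fin; zero; suc; toℕ)
import Data.Fin.Properties as Fin
open import Data.Nat using (ℕ; zero; suc; _+_; _*_; _≤_; _<_; s<s; z<s)
import Data.Nat.Properties as ℕ
open import Data.Product using (Σ; ∃; ∃-syntax; _×_; _,_; proj₁; proj₂)
open import Data.Product.Function.NonDependent.Propositional using (_×-↔_)
open import Data.Sum using (_⊎_; inj₁; inj₂; swap)
open import Data.Sum.Function.Propositional using (_⊎-↔_)
open import Data.Unit using (⊤; tt)
open import Function using (_∘_; _↔_; Inverse; mk↔ₛ′)
open import Function.Properties.Inverse using (↔-refl; ↔-sym; ↔-trans; ↔⇒↣)
open import Relation.Binary.Definitions
  using (Decidable; DecidableEquality; Irreflexive; Symmetric)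
open import Relation.Binary.PropositionalEquality
  using (_≡_; _≢_; refl; sym; trans; cong)
open import Relation.Nullary using (¬_; yes; no)
open import Relation.Nullary.Decidable using (_×-dec_; _⊎-dec_; via-injection)

-- Finite simple graphs, with the vertex set listed as u 0, …, u (order - 1).

record Graph : Set₁ where
  field
    V          : Set
    order      : ℕ
    vertices   : Fin order ↔ V
    Adj        : V → V → Set
    adj?       : Decidable Adj
    adj-sym    : Symmetric Adj
    adj-irrefl : Irreflexive _≡_ Adj

  u : Fin order → V
  u = Inverse.to vertices

  _≟_ : DecidableEquality V
  _≟_ = via-injection (↔⇒↣ (↔-sym vertices)) Fin._≟_

open Graph using (V; order; vertices)

-- Each edge {u i , u j} is represented once, by its indices in increasing
-- order; the proofs are irrelevant so that edges are determined by their
-- ends.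

record Edge (G : Graph) : Set where
  constructor edge
  open Graph G using (Adj; u)
  field
    lo hi      : Fin (order G)
    .lo<hi     : lo Fin.< hi
    .adjacent  : Adj (u lo) (u hi)

module _ {G : Graph} where
  open Graph G using (u; _≟_)

  Incident : V G → Edge G → Set
  Incident v e = v ≡ u (Edge.lo e) ⊎ v ≡ u (Edge.hi e)

  incident? : Decidable Incident
  incident? v e = (v ≟ u (Edge.lo e)) ⊎-dec (v ≟ u (Edge.hi e))

private
  Finite : Set → Set
  Finite A = ∃[ k ] (Fin k ↔ A)

  finite-Σ : ∀ n {B : Fin n → Set} → (∀ i → Finite (B i)) → Finite (Σ (Fin n) B)
  finite-Σ zero fin = 0 , mk↔ₛ′ (λ ()) (λ ()) (λ ()) (λ ())
  finite-Σ (suc n) {B} fin =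
    let (k , f) = fin zero
        (l , g) = finite-Σ n (fin ∘ suc)
    in k + l , ↔-trans Fin.+↔⊎ (↔-trans (f ⊎-↔ g) split)
    where
    split : (B zero ⊎ Σ (Fin n) (B ∘ suc)) ↔ Σ (Fin (suc n)) B
    split = mk↔ₛ′
      (λ { (inj₁ b) → zero , b ; (inj₂ (i , b)) → suc i , b })
      (λ { (zero , b) → inj₁ b ; (suc i , b) → inj₂ (i , b) })
      (λ { (zero , b) → refl ; (suc i , b) → refl })
      (λ { (inj₁ b) → refl ; (inj₂ (i , b)) → refl })

  record Joined (G : Graph) (i j : Fin (order G)) : Set where
    constructor joined
    open Graph G using (Adj; u)
    field
      .i<j : i Fin.< j
      .adj : Adj (u i) (u j)

  finite-Joined : ∀ G i j → Finite (Joined G i j)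
  finite-Joined G i j with (i Fin.<? j) ×-dec Graph.adj? G (Graph.u G i) (Graph.u G j)
  ... | yes (p , q) = 1 , mk↔ₛ′ (λ _ → joined p q) (λ _ → zero) (λ _ → refl) (λ { zero → refl })
  ... | no ¬pq = 0 , mk↔ₛ′ (λ ()) (⊥-elim ∘ absurd) (λ x → ⊥-elim (absurd x)) (λ ())
    where
    absurd : Joined G i j → ⊥
    absurd (joined p q) = Data.Empty.⊥-elim-irr (¬pq (p , q))

  finite-Edge : ∀ G → Finite (Edge G)
  finite-Edge G =
    let (k , f) = finite-Σ (order G) (λ i → finite-Σ (order G) (finite-Joined G i))
    in k , ↔-trans f (mk↔ₛ′
      (λ { (i , j , joined p q) → edge i j p q })
      (λ { (edge i j p q) → i , j , joined p q })
      (λ _ → refl) (λ _ → refl))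

size : Graph → ℕ
size G = proj₁ (finite-Edge G)

edges : ∀ G → Fin (size G) ↔ Edge G
edges G = proj₂ (finite-Edge G)

-- The subdivision graph S(G): inj₂ e is the vertex inserted into e.

module _ (G : Graph) where

  SubdivisionAdj : V G ⊎ Edge G → V G ⊎ Edge G → Set
  SubdivisionAdj (inj₁ v) (inj₁ w) = ⊥
  SubdivisionAdj (inj₁ v) (inj₂ e) = Incident {G} v e
  SubdivisionAdj (inj₂ e) (inj₁ v) = Incident {G} v e
  SubdivisionAdj (inj₂ e) (inj₂ f) = ⊥

  subdivision : Graph
  subdivision = record
    { V          = V G ⊎ Edge G
    ; order      = order G + size G
    ; vertices   = ↔-trans Fin.+↔⊎ (vertices G ⊎-↔ edges G)
    ; Adj        = SubdivisionAdj
    ; adj?       = dec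
    ; adj-sym    = λ {x} {y} → symm x y
    ; adj-irrefl = λ { {inj₁ _} refl () ; {inj₂ _} refl () }
    }
    where
    dec : Decidable SubdivisionAdj
    dec (inj₁ v) (inj₁ w) = no λ ()
    dec (inj₁ v) (inj₂ e) = incident? {G} v e
    dec (inj₂ e) (inj₁ v) = incident? {G} v e
    dec (inj₂ e) (inj₂ f) = no λ ()

    symm : ∀ x y → SubdivisionAdj x y → SubdivisionAdj y x
    symm (inj₁ v) (inj₂ e) p = p
    symm (inj₂ e) (inj₁ v) p = p

-- The SVN corona: inj₂ (v , h) is the vertex h of the copy of H associated
-- with v.

module _ (G H : Graph) where
  private
    SG = subdivision G
    module SG = Graph SG
    module G = Graph G
    module H = Graph H

  CoronaAdj : V SG ⊎ (V G × V H) → V SG ⊎ (V G × V H) → Set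
  CoronaAdj (inj₁ x)       (inj₁ y)       = SG.Adj x y
  CoronaAdj (inj₁ x)       (inj₂ (v , h)) = SG.Adj (inj₁ v) x
  CoronaAdj (inj₂ (v , h)) (inj₁ x)       = SG.Adj (inj₁ v) x
  CoronaAdj (inj₂ (v , h)) (inj₂ (w , k)) = v ≡ w × H.Adj h k

  infixl 7 _⊡_

  _⊡_ : Graph
  _⊡_ = record
    { V          = V SG ⊎ (V G × V H)
    ; order      = order SG + order G * order H
    ; vertices   = ↔-trans Fin.+↔⊎
        (vertices SG ⊎-↔ ↔-trans Fin.*↔× (vertices G ×-↔ vertices H))
    ; Adj        = CoronaAdj
    ; adj?       = dec
    ; adj-sym    = λ {x} {y} → symm x y
    ; adj-irrefl = λ
        { {inj₁ _} refl p → SG.adj-irrefl refl p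
        ; {inj₂ _} refl (_ , p) → H.adj-irrefl refl p }
    }
    where
    dec : Decidable CoronaAdj
    dec (inj₁ x)       (inj₁ y)       = SG.adj? x y
    dec (inj₁ x)       (inj₂ (v , h)) = SG.adj? (inj₁ v) x
    dec (inj₂ (v , h)) (inj₁ x)       = SG.adj? (inj₁ v) x
    dec (inj₂ (v , h)) (inj₂ (w , k)) = (v G.≟ w) ×-dec H.adj? h k

    symm : ∀ x y → CoronaAdj x y → CoronaAdj y x
    symm (inj₁ x)       (inj₁ y)       p       = SG.adj-sym {x} {y} p
    symm (inj₁ x)       (inj₂ (v , h)) p       = p
    symm (inj₂ (v , h)) (inj₁ x)       p       = p
    symm (inj₂ (v , h)) (inj₂ (w , k)) (q , p) = sym q , H.adj-sym p

module _ {n : ℕ} where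

  -- j is the successor of i modulo n
  Next : Fin n → Fin n → Set
  Next i j = toℕ j ≡ suc (toℕ i) ⊎ (suc (toℕ i) ≡ n × toℕ j ≡ 0)

  next? : Decidable Next
  next? i j = (toℕ j ℕ.≟ suc (toℕ i)) ⊎-dec ((suc (toℕ i) ℕ.≟ n) ×-dec (toℕ j ℕ.≟ 0))

  next-irrefl : 1 < n → ∀ i → ¬ Next i i
  next-irrefl 1<n i (inj₁ p) = ℕ.1+n≢n (sym p)
  next-irrefl 1<n i (inj₂ (p , q)) = ℕ.<⇒≢ 1<n (trans (cong suc (sym q)) p)

C : (n : ℕ) → 2 < n → Graph
C n 2<n = record
  { V          = Fin n
  ; order      = n
  ; vertices   = ↔-refl
  ; Adj        = λ i j → Next i j ⊎ Next j i
  ; adj?       = λ i j → next? i j ⊎-dec next? j i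
  ; adj-sym    = swap
  ; adj-irrefl = λ
      { {i} refl (inj₁ p) → next-irrefl 1<n i p
      ; {i} refl (inj₂ p) → next-irrefl 1<n i p }
  }
  where
  1<n : 1 < n
  1<n = ℕ.<-trans (s<s z<s) 2<n

module _ {t : ℕ} where

  -- zero is the centre
  StarAdj : Fin (suc t) → Fin (suc t) → Set
  StarAdj zero    zero    = ⊥
  StarAdj zero    (suc _) = ⊤
  StarAdj (suc _) zero    = ⊤
  StarAdj (suc _) (suc _) = ⊥

S : ℕ → Graph
S t = record
  { V          = Fin (suc t)
  ; order      = suc t
  ; vertices   = ↔-refl
  ; Adj        = StarAdj
  ; adj?       = dec
  ; adj-sym    = λ {i} {j} → symm i j
  ; adj-irrefl = λ { {zero} refl () ; {suc _} refl () }
  }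
  where
  dec : Decidable (StarAdj {t})
  dec zero    zero    = no λ ()
  dec zero    (suc _) = yes tt
  dec (suc _) zero    = yes tt
  dec (suc _) (suc _) = no λ ()

  symm : ∀ i j → StarAdj {t} i j → StarAdj j i
  symm zero    (suc _) _ = tt
  symm (suc _) zero    _ = tt

module _ (G : Graph) where
  open Graph G using (Adj)

  IsProper : ∀ {k} → (V G → Fin k) → Set
  IsProper c = ∀ {v w} → Adj v w → c v ≢ c w

  IsBVertex : ∀ {k} → (V G → Fin k) → V G → Set
  IsBVertex c v = ∀ j → j ≢ c v → ∃[ w ] (Adj v w × c w ≡ j)

  record BColoring (k : ℕ) : Set where
    field
      color    : V G → Fin k
      proper   : IsProper color
      bVertex  : ∀ i → ∃[ v ] (color v ≡ i × IsBVertex color v)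

-- φ G ≔ m expresses that the b-chromatic number of G is m, that is, m is the
-- maximum k for which G has a b-chromatic coloring with k colors.

infix 4 φ_≔_

φ_≔_ : Graph → ℕ → Set
φ G ≔ m = BColoring G m × (∀ k → BColoring G k → k ≤ m)

{-# OPTIONS --safe #-}

-- Upper bounds: the vertices inserted into the edges have degree 2t + 4, the
-- centres of the stars degree t + 2, all others degree at most 3.  Hence at
-- most 2t + 5 colours occur; beyond t + 3 colours all b-vertices lie on the n
-- edges, and beyond 4 colours on the n edges or the n centres.
--
-- Lower bounds: for n < k ≤ min(2n, t + 3) colours, give the edges n distinct
-- colours, let the centres use all the remaining ones, and let the leaves of
-- each star show everything but its centre and the two edges it sees.
-- For k ≤ min(n, 2t + 5) colours, give edge i colour i (and 0 once i ≥ k); its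
-- 2t + 4 neighbours must show all other colours.  The vertices around i get the
-- colours i − s mod k for s = 2, 4, 6, … and s = k − 1; the colour i − d is then
-- found around i if d is even or k − 1, and around i + 1, as (i + 1) − (d + 1),
-- if d is odd.
module Submission where

open import Defs
open import Data.Bool using (Bool; true; false; T; if_then_else_; _∧_)
import Data.Bool.Properties as Bool
open import Data.Empty using (⊥-elim-irr)
open import Data.Fin as Fin using (Fin; zero; suc; toℕ; fromℕ<; inject≤; punchIn; punchOut; splitAt; _↑ˡ_; _↑ʳ_)
import Data.Fin.Properties as Fin
open import Data.Nat using (ℕ; zero; suc; _+_; _*_; _∸_; _⊓_; _≤_; _<_; _≤ᵇ_; _<ᵇ_; ⌊_/2⌋; ⌈_/2⌉; z≤n; s≤s; z<s; s<s)
import Data.Nat.Properties as ℕ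
open import Data.Nat.Solver using (module +-*-Solver)
open import Data.Product using (∃; _×_; _,_; proj₁; proj₂)
open import Data.Sum using (_⊎_; inj₁; inj₂; [_,_]′; swap)
open import Function using (_∘_; Equivalence)
open import Function.Definitions using (Injective)
open import Relation.Binary.PropositionalEquality using (_≡_; _≢_; refl; sym; trans; cong; subst)
open import Relation.Nullary using (¬_; yes; no; contradiction)
open import Relation.Nullary.Decidable using (recompute)
open +-*-Solver using (solve; _:=_; _:+_; _:*_; con)

-- Counting and complements in finite sets

surjection⇒≤ : ∀ {d k} (f : Fin d → Fin k) → (∀ j → ∃ λ x → f x ≡ j) → k ≤ d
surjection⇒≤ f surj = Fin.injective⇒≤ {f = proj₁ ∘ surj}
  λ {i} {j} eq → trans (sym (proj₂ (surj i))) (trans (cong f eq) (proj₂ (surj j)))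

-- Truncation rather than reduction: surplus arguments all repeat the last value `m`.
clamp : ∀ m → ℕ → Fin (suc m)
clamp m x = fromℕ< (s≤s (ℕ.m⊓n≤n x m))

toℕ-clamp : ∀ m x → toℕ (clamp m x) ≡ x ⊓ m
toℕ-clamp m x = Fin.toℕ-fromℕ< _

clamp-toℕ : ∀ {m} (j : Fin (suc m)) → clamp m (toℕ j) ≡ j
clamp-toℕ {m} j = Fin.toℕ-injective
  (trans (toℕ-clamp m (toℕ j)) (ℕ.m≤n⇒m⊓n≡m (Fin.toℕ≤pred[n] j)))

-- The values of `p` are removed one at a time: `punchOut` at `p zero` shrinks the range for the
-- remaining ones, and `punchIn` carries the result back.
complement : ∀ s {m} (p : Fin s → Fin (s + m)) → Injective _≡_ _≡_ p →
  ∃ λ (f : Fin m → Fin (s + m)) →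
    (∀ x y → f x ≢ p y) × (∀ j → (∀ y → j ≢ p y) → ∃ λ x → f x ≡ j)
complement zero p inj = (λ x → x) , (λ _ ()) , λ j _ → j , refl
complement (suc s) {m} p inj = f , avoids , covers
  where
  a = p zero

  a≢ : ∀ y → a ≢ p (suc y)
  a≢ y eq with () ← inj eq

  p′ : Fin s → Fin (s + m)
  p′ y = punchOut (a≢ y)

  rec = complement s p′ λ {x} {y} eq →
    Fin.suc-injective (inj (Fin.punchOut-injective (a≢ x) (a≢ y) eq))

  f = punchIn a ∘ proj₁ rec

  avoids : ∀ x y → f x ≢ p y
  avoids x zero eq = Fin.punchInᵢ≢i a _ eq
  avoids x (suc y) eq = proj₁ (proj₂ rec) x y
    (Fin.punchIn-injective a _ _ (trans eq (sym (Fin.punchIn-punchOut (a≢ y)))))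

  covers : ∀ j → (∀ y → j ≢ p y) → ∃ λ x → f x ≡ j
  covers j j≢ = x , trans (cong (punchIn a) eq) (Fin.punchIn-punchOut a≢j)
    where
    a≢j : a ≢ j
    a≢j = j≢ zero ∘ sym

    hit = proj₂ (proj₂ rec) (punchOut a≢j) λ y eq →
      j≢ (suc y) (Fin.punchOut-injective a≢j (a≢ y) eq)
    x = proj₁ hit
    eq = proj₂ hit

-- The cyclic successor relation

module _ {n : ℕ} where

  next-functional : ∀ {i j j′ : Fin n} → Next i j → Next i j′ → j ≡ j′
  next-functional (inj₁ p) (inj₁ q) = Fin.toℕ-injective (trans p (sym q))
  next-functional {j = j} (inj₁ p) (inj₂ (q , _)) =
    contradiction (trans p q) (ℕ.<⇒≢ (Fin.toℕ<n j))
  next-functional {j′ = j′} (inj₂ (p , _)) (inj₁ q) =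
    contradiction (trans q p) (ℕ.<⇒≢ (Fin.toℕ<n j′))
  next-functional (inj₂ (_ , p)) (inj₂ (_ , q)) = Fin.toℕ-injective (trans p (sym q))

  next-injective : ∀ {i i′ j : Fin n} → Next i j → Next i′ j → i ≡ i′
  next-injective (inj₁ p) (inj₁ q) = Fin.toℕ-injective (ℕ.suc-injective (trans (sym p) q))
  next-injective (inj₁ p) (inj₂ (_ , q)) with () ← trans (sym p) q
  next-injective (inj₂ (_ , p)) (inj₁ q) with () ← trans (sym q) p
  next-injective (inj₂ (p , _)) (inj₂ (q , _)) =
    Fin.toℕ-injective (ℕ.suc-injective (trans p (sym q)))

  -- Two vertices succeeding each other would close a cycle of length at most 2.
  next-asym : 2 < n → ∀ {i j : Fin n} → Next i j → ¬ Next j i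
  next-asym _ (inj₁ p) (inj₁ q) = ℕ.<⇒≢ (ℕ.m≤n⇒m≤1+n ℕ.≤-refl) (trans q (cong suc p))
  next-asym 2<n (inj₁ p) (inj₂ (q , r)) =
    ℕ.<⇒≢ 2<n (trans (cong (2 +_) (sym r)) (trans (cong suc (sym p)) q))
  next-asym 2<n (inj₂ (p , r)) (inj₁ q) =
    ℕ.<⇒≢ 2<n (trans (cong (2 +_) (sym r)) (trans (cong suc (sym q)) p))
  next-asym 2<n (inj₂ (p , _)) (inj₂ (_ , r)) =
    ℕ.<⇒≢ (ℕ.<-trans (s<s z<s) 2<n) (trans (cong suc (sym r)) p)

  successor : ∀ (i : Fin n) → ∃ (Next i)
  successor i with suc (toℕ i) ℕ.<? n
  ... | yes si<n = fromℕ< si<n , inj₁ (Fin.toℕ-fromℕ< si<n)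
  ... | no si≮n = fromℕ< 0<n , inj₂ (ℕ.≤-antisym (Fin.toℕ<n i) (ℕ.≮⇒≥ si≮n) , Fin.toℕ-fromℕ< 0<n)
    where
    0<n : 0 < n
    0<n = ℕ.≤-<-trans z≤n (Fin.toℕ<n i)

predecessor : ∀ {n} (j : Fin n) → ∃ λ i → Next i j
predecessor {suc m} zero = Fin.fromℕ m , inj₂ (cong suc (Fin.toℕ-fromℕ m) , refl)
predecessor (suc j) = Fin.inject₁ j , inj₁ (cong suc (sym (Fin.toℕ-inject₁ j)))

prev : ∀ {n} → Fin n → Fin n
prev = proj₁ ∘ predecessor

next-prev : ∀ {n} (j : Fin n) → Next (prev j) j
next-prev = proj₂ ∘ predecessor

-- Parity and cyclic distances between colours

halve : ∀ d → ∃ λ h → d ≡ h + h ⊎ d ≡ suc (h + h)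
halve zero = zero , inj₁ refl
halve (suc d) with halve d
... | h , inj₁ refl = h , inj₂ refl
... | h , inj₂ refl = suc h , inj₁ (cong suc (sym (ℕ.+-suc h h)))

module _ {K : ℕ} where

  -- j ≡ a − d modulo 1 + K, for d ≤ K
  Back : ℕ → Fin (suc K) → Fin (suc K) → Set
  Back d a j = toℕ a ≡ toℕ j + d ⊎ toℕ a + suc K ≡ toℕ j + d

  back-refl : ∀ {a} → Back 0 a a
  back-refl = inj₁ (sym (ℕ.+-identityʳ _))

  back-target-unique : ∀ {d a j j′} → Back d a j → Back d a j′ → j ≡ j′
  back-target-unique {d} (inj₁ p) (inj₁ q) = Fin.toℕ-injective (ℕ.+-cancelʳ-≡ d _ _ (trans (sym p) q))
  back-target-unique {d} (inj₂ p) (inj₂ q) = Fin.toℕ-injective (ℕ.+-cancelʳ-≡ d _ _ (trans (sym p) q))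
  back-target-unique {d} {a} {j} {j′} (inj₁ p) (inj₂ q) = contradiction (Fin.toℕ<n j′) (ℕ.≤⇒≯ (wrapped p q))
    where
    wrapped : ∀ {j j′ : ℕ} → toℕ a ≡ j + d → toℕ a + suc K ≡ j′ + d → suc K ≤ j′
    wrapped {j} {j′} p q = ℕ.+-cancelʳ-≤ d _ _ (begin
      suc K + d       ≤⟨ ℕ.+-monoʳ-≤ (suc K) (ℕ.m≤n+m d j) ⟩
      suc K + (j + d) ≡⟨ cong (suc K +_) p ⟨
      suc K + toℕ a   ≡⟨ ℕ.+-comm (suc K) (toℕ a) ⟩
      toℕ a + suc K   ≡⟨ q ⟩
      j′ + d          ∎)
      where open ℕ.≤-Reasoning
  back-target-unique p@(inj₂ _) q@(inj₁ _) = sym (back-target-unique q p)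

  -- If only one of the two equations wraps around, then `toℕ j ≤ toℕ a` turns the wrapped one into
  -- `suc K ≤ d′`.
  back-distance-unique : ∀ {d d′ a j} → d ≤ K → d′ ≤ K → Back d a j → Back d′ a j → d ≡ d′
  back-distance-unique {j = j} _ _ (inj₁ p) (inj₁ q) = ℕ.+-cancelˡ-≡ (toℕ j) _ _ (trans (sym p) q)
  back-distance-unique {j = j} _ _ (inj₂ p) (inj₂ q) = ℕ.+-cancelˡ-≡ (toℕ j) _ _ (trans (sym p) q)
  back-distance-unique {d} {d′} {a} {j} _ d′≤K (inj₁ p) (inj₂ q) = contradiction (s≤s d′≤K) (ℕ.≤⇒≯ (
    ℕ.+-cancelˡ-≤ (toℕ j) _ _ (begin
      toℕ j + suc K  ≤⟨ ℕ.+-monoˡ-≤ (suc K) (subst (toℕ j ≤_) (sym p) (ℕ.m≤m+n (toℕ j) d)) ⟩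
      toℕ a + suc K  ≡⟨ q ⟩
      toℕ j + d′     ∎)))
    where open ℕ.≤-Reasoning
  back-distance-unique d≤K d′≤K p@(inj₂ _) q@(inj₁ _) = sym (back-distance-unique d′≤K d≤K q p)

  -- This is `a − d = (a + 1) − (d + 1)`, modulo `suc K`.
  back-next : ∀ {d a b j} → d ≤ K → Next a b → Back d a j → Back (suc d) b j
  back-next {d} {j = j} _ (inj₁ b≡1+a) (inj₁ p) =
    inj₁ (trans b≡1+a (trans (cong suc p) (sym (ℕ.+-suc (toℕ j) d))))
  back-next {d} {j = j} _ (inj₁ b≡1+a) (inj₂ p) =
    inj₂ (trans (cong (_+ suc K) b≡1+a) (trans (cong suc p) (sym (ℕ.+-suc (toℕ j) d))))
  back-next {d} {j = j} _ (inj₂ (1+a≡k , b≡0)) (inj₁ p) =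
    inj₂ (trans (cong (_+ suc K) b≡0) (trans (sym 1+a≡k) (trans (cong suc p) (sym (ℕ.+-suc (toℕ j) d)))))
  -- Here `a` is the largest element `K`, so going back `d ≤ K` steps from it cannot wrap around.
  back-next {d} {a} {j = j} d≤K (inj₂ (1+a≡k , b≡0)) (inj₂ p) = contradiction (begin-strict
      toℕ j + d       ≤⟨ ℕ.+-mono-≤ (Fin.toℕ≤pred[n] j) d≤K ⟩
      K + K           <⟨ ℕ.+-monoʳ-< K (ℕ.n<1+n K) ⟩
      K + suc K       ≡⟨ cong (_+ suc K) (ℕ.suc-injective 1+a≡k) ⟨
      toℕ a + suc K   ≡⟨ p ⟩
      toℕ j + d       ∎) (ℕ.<-irrefl refl)
    where open ℕ.≤-Reasoning

  go-back : ∀ {d} → d ≤ K → ∀ a → ∃ (Back d a)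
  go-back {d} d≤K a with d ℕ.≤? toℕ a
  ... | yes d≤a = fromℕ< a∸d<k ,
      inj₁ (sym (trans (cong (_+ d) (Fin.toℕ-fromℕ< a∸d<k)) (ℕ.m∸n+n≡m d≤a)))
    where
    a∸d<k : toℕ a ∸ d < suc K
    a∸d<k = ℕ.≤-<-trans (ℕ.m∸n≤m (toℕ a) d) (Fin.toℕ<n a)
  ... | no d≰a = fromℕ< a+k∸d<k ,
      inj₂ (sym (trans (cong (_+ d) (Fin.toℕ-fromℕ< a+k∸d<k))
        (ℕ.m∸n+n≡m (ℕ.≤-trans d≤K (ℕ.≤-trans (ℕ.n≤1+n K) (ℕ.m≤n+m (suc K) (toℕ a)))))))
    where
    a+k∸d<k : toℕ a + suc K ∸ d < suc K
    a+k∸d<k = ℕ.m<n+o⇒m∸n<o (toℕ a + suc K) d (ℕ.+-monoˡ-< (suc K) (ℕ.≰⇒> d≰a))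

  distance : ∀ {a j} → a ≢ j → ∃ λ d → 0 < d × d ≤ K × Back d a j
  distance {a} {j} a≢j with toℕ j ℕ.≤? toℕ a
  ... | yes j≤a = toℕ a ∸ toℕ j , ℕ.m<n⇒0<n∸m (ℕ.≤∧≢⇒< j≤a (a≢j ∘ sym ∘ Fin.toℕ-injective)) ,
      ℕ.≤-trans (ℕ.m∸n≤m (toℕ a) (toℕ j)) (Fin.toℕ≤pred[n] a) , inj₁ (sym (ℕ.m+[n∸m]≡n j≤a))
  ... | no j≰a = toℕ a + suc K ∸ toℕ j , ℕ.m<n⇒0<n∸m j<a+k ,
      ℕ.m≤n+o⇒m∸n≤o (toℕ a + suc K) (toℕ j)
        (subst (_≤ toℕ j + K) (sym (ℕ.+-suc (toℕ a) K)) (ℕ.+-monoˡ-≤ K (ℕ.≰⇒> j≰a))) ,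
      inj₂ (sym (ℕ.m+[n∸m]≡n (ℕ.<⇒≤ j<a+k)))
    where
    j<a+k : toℕ j < toℕ a + suc K
    j<a+k = ℕ.<-≤-trans (Fin.toℕ<n j) (ℕ.m≤n+m (suc K) (toℕ a))

-- Orienting the edges of the cycle

module CycleEdges {n : ℕ} (2<n : 2 < n) where

  Cₙ : Graph
  Cₙ = C n 2<n

  -- The adjacency stored in an edge is irrelevant; decidability recovers a proof that admits case
  -- analysis.
  orientation : (e : Edge Cₙ) → Next (Edge.lo e) (Edge.hi e) ⊎ Next (Edge.hi e) (Edge.lo e)
  orientation (edge lo hi _ adj) = recompute (Graph.adj? Cₙ lo hi) adj

  -- The ends in cyclic order; this is the stored increasing order except for the edge that closes
  -- the cycle.
  start finish : Edge Cₙ → Fin n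
  start e = [ (λ _ → Edge.lo e) , (λ _ → Edge.hi e) ]′ (orientation e)
  finish e = [ (λ _ → Edge.hi e) , (λ _ → Edge.lo e) ]′ (orientation e)

  next-ends : ∀ e → Next (start e) (finish e)
  next-ends e with orientation e
  ... | inj₁ p = p
  ... | inj₂ p = p

  incident⇒end : ∀ {i} e → Incident {Cₙ} i e → i ≡ start e ⊎ i ≡ finish e
  incident⇒end e with orientation e
  ... | inj₁ _ = λ inc → inc
  ... | inj₂ _ = swap

  end⇒incident : ∀ {i} e → i ≡ start e ⊎ i ≡ finish e → Incident {Cₙ} i e
  end⇒incident e with orientation e
  ... | inj₁ _ = λ inc → inc
  ... | inj₂ _ = swap

  edge-between : ∀ {i j} → Next i j → ∃ λ e → start e ≡ i
  edge-between {i} {j} i→j@(inj₁ p) = e , start-e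
    where
    e : Edge Cₙ
    e = edge i j (ℕ.≤-reflexive (sym p)) (inj₁ i→j)

    start-e : start e ≡ i
    start-e with orientation e
    ... | inj₁ _ = refl
    ... | inj₂ j→i = contradiction j→i (next-asym 2<n i→j)
  edge-between {i} {j} i→j@(inj₂ (p , q)) = e , start-e
    where
    j<i : toℕ j < toℕ i
    j<i = ℕ.≤∧≢⇒< (subst (_≤ toℕ i) (sym q) z≤n) λ j≡i →
      ℕ.<⇒≢ (ℕ.<-trans (s<s z<s) 2<n) (trans (cong suc (trans (sym q) j≡i)) p)

    e : Edge Cₙ
    e = edge j i j<i (inj₂ i→j)

    start-e : start e ≡ i
    start-e with orientation e
    ... | inj₁ j→i = contradiction j→i (next-asym 2<n i→j)
    ... | inj₂ _ = refl

  ends-not-swapped : ∀ (e f : Edge Cₙ) → Edge.lo e ≡ Edge.hi f → Edge.lo f ≢ Edge.hi e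
  ends-not-swapped (edge lo hi p _) (edge .hi .lo q _) refl refl = ⊥-elim-irr (ℕ.<-asym p q)

  -- The start determines the finish, and the two ends determine the edge; opposite orientations
  -- would make one of the stored pairs decreasing.
  start-injective : ∀ {e f} → start e ≡ start f → e ≡ f
  start-injective {e} {f} = λ eq → lemma eq
    (next-functional (next-ends e) (subst (λ i → Next i (finish f)) (sym eq) (next-ends f)))
    where
    lemma : start e ≡ start f → finish e ≡ finish f → e ≡ f
    lemma with orientation e | orientation f
    ... | inj₁ _ | inj₁ _ = λ { refl refl → refl }
    ... | inj₂ _ | inj₂ _ = λ { refl refl → refl }
    ... | inj₁ _ | inj₂ _ = λ p q → contradiction (sym q) (ends-not-swapped e f p)
    ... | inj₂ _ | inj₁ _ = λ p q → contradiction (sym p) (ends-not-swapped e f q)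

  edgeFrom edgeTo : Fin n → Edge Cₙ
  edgeFrom i = proj₁ (edge-between (proj₂ (successor i)))
  edgeTo = edgeFrom ∘ prev

  start-edgeFrom : ∀ i → start (edgeFrom i) ≡ i
  start-edgeFrom i = proj₂ (edge-between (proj₂ (successor i)))

  finish-edgeTo : ∀ i → finish (edgeTo i) ≡ i
  finish-edgeTo i = next-functional
    (subst (λ h → Next h (finish (edgeTo i))) (start-edgeFrom (prev i)) (next-ends (edgeTo i)))
    (next-prev i)

  incident-edgeFrom : ∀ i → Incident {Cₙ} i (edgeFrom i)
  incident-edgeFrom i = end⇒incident (edgeFrom i) (inj₁ (sym (start-edgeFrom i)))

  incident-edgeTo : ∀ i → Incident {Cₙ} i (edgeTo i)
  incident-edgeTo i = end⇒incident (edgeTo i) (inj₂ (sym (finish-edgeTo i)))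

  incident⇒edge : ∀ {i} e → Incident {Cₙ} i e → edgeFrom i ≡ e ⊎ edgeTo i ≡ e
  incident⇒edge e inc with incident⇒end e inc
  ... | inj₁ refl = inj₁ (start-injective (start-edgeFrom _))
  ... | inj₂ refl = inj₂ (start-injective
    (trans (start-edgeFrom _) (next-injective (next-prev _) (next-ends e))))

-- Neighbourhoods and degrees in the corona

module Corona {n : ℕ} (t : ℕ) (2<n : 2 < n) where
  open CycleEdges 2<n

  G : Graph
  G = Cₙ ⊡ S t

  pattern hub i = inj₁ (inj₁ i)
  pattern rim e = inj₁ (inj₂ e)
  pattern copy i h = inj₂ (i , h)

  -- The vertices inserted into the two edges at `i`: the whole neighbourhood of `hub i`, and the
  -- neighbours that the star at `i` has outside itself.
  spoke : Fin n → Fin 2 → Graph.V G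
  spoke i zero = rim (edgeFrom i)
  spoke i (suc zero) = rim (edgeTo i)

  spoke-cover : ∀ {i} e → Incident {Cₙ} i e → ∃ λ x → spoke i x ≡ rim e
  spoke-cover e inc with incident⇒edge e inc
  ... | inj₁ refl = zero , refl
  ... | inj₂ refl = suc zero , refl

  -- All 2 + t vertices attached to the two edges at i.
  around : Fin n → Fin (2 + t) → Graph.V G
  around i zero = hub i
  around i (suc h) = copy i h

  rim-around : ∀ {i} e → Incident {Cₙ} i e → ∀ q → Graph.Adj G (rim e) (around i q)
  rim-around e inc zero = inc
  rim-around e inc (suc h) = inc

  around-ends : Edge Cₙ → Fin ((2 + t) + (2 + t)) → Graph.V G
  around-ends e = [ around (start e) , around (finish e) ]′ ∘ splitAt (2 + t)

  around-ends-cover : ∀ {i} e → Incident {Cₙ} i e → ∀ q → ∃ λ x → around-ends e x ≡ around i q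
  around-ends-cover e inc q with incident⇒end e inc
  ... | inj₁ refl = q ↑ˡ (2 + t) , cong [ around _ , around _ ]′ (Fin.splitAt-↑ˡ (2 + t) q (2 + t))
  ... | inj₂ refl = (2 + t) ↑ʳ q , cong [ around _ , around _ ]′ (Fin.splitAt-↑ʳ (2 + t) (2 + t) q)

  degree : Graph.V G → ℕ
  degree (hub _) = 2
  degree (rim _) = (2 + t) + (2 + t)
  degree (copy _ zero) = 2 + t
  degree (copy _ (suc _)) = 3

  neighbour : ∀ v → Fin (degree v) → Graph.V G
  neighbour (hub i) = spoke i
  neighbour (rim e) = around-ends e
  neighbour (copy i zero) zero = spoke i zero
  neighbour (copy i zero) (suc zero) = spoke i (suc zero)
  neighbour (copy i zero) (suc (suc x)) = copy i (suc x)
  neighbour (copy i (suc _)) zero = copy i zero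
  neighbour (copy i (suc _)) (suc b) = spoke i b

  neighbour-cover : ∀ v w → Graph.Adj G v w → ∃ λ x → neighbour v x ≡ w
  neighbour-cover (hub i) (rim e) inc = spoke-cover e inc
  neighbour-cover (rim e) (hub i) inc = around-ends-cover e inc zero
  neighbour-cover (rim e) (copy i h) inc = around-ends-cover e inc (suc h)
  neighbour-cover (copy i zero) (rim e) inc with spoke-cover e inc
  ... | zero , eq = zero , eq
  ... | suc zero , eq = suc zero , eq
  neighbour-cover (copy i zero) (copy .i (suc x)) (refl , _) = suc (suc x) , refl
  neighbour-cover (copy i (suc _)) (rim e) inc with spoke-cover e inc
  ... | b , eq = suc b , eq
  neighbour-cover (copy i (suc _)) (copy .i zero) (refl , _) = zero , refl

  -- A b-vertex meets every colour on itself or on one of its listed neighbours.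
  bVertex⇒≤ : ∀ {k} {c : Graph.V G → Fin k} v → IsBVertex G c v → k ≤ suc (degree v)
  bVertex⇒≤ {k} {c} v b = surjection⇒≤ f surj
    where
    f : Fin (suc (degree v)) → Fin k
    f zero = c v
    f (suc x) = c (neighbour v x)

    surj : ∀ j → ∃ λ x → f x ≡ j
    surj j with j Fin.≟ c v
    ... | yes eq = zero , sym eq
    ... | no j≢ with b j j≢
    ...   | w , adj , eq with neighbour-cover v w adj
    ...     | x , refl = suc x , eq

  -- Upper bounds from the location of b-vertices

  module _ {k} (β : BColoring G k) where
    open BColoring β

    colours≤range : ∀ {d} (f : Fin d → Graph.V G) →
      (∀ v → IsBVertex G color v → ∃ λ x → f x ≡ v) → k ≤ d
    colours≤range f cover = surjection⇒≤ (color ∘ f) λ j →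
      let (v , cv≡j , b) = bVertex j ; (x , fx≡v) = cover v b
      in x , trans (cong color fx≡v) cv≡j

    edges-only : 0 < t → 3 + t < k → k ≤ n
    edges-only 0<t 3+t<k = colours≤range (λ i → rim (edgeFrom i)) cover
      where
      cover : ∀ v → IsBVertex G color v → ∃ λ i → rim (edgeFrom i) ≡ v
      cover (rim e) b = start e , cong (inj₁ ∘ inj₂) (start-injective (start-edgeFrom (start e)))
      cover (hub i) b = contradiction
        (ℕ.≤-<-trans (ℕ.m≤m+n 3 t) 3+t<k) (ℕ.≤⇒≯ (bVertex⇒≤ (hub i) b))
      cover (copy i zero) b = contradiction 3+t<k (ℕ.≤⇒≯ (bVertex⇒≤ (copy i zero) b))
      -- A leaf allows at most 4 colours, and `0 < t` gives `4 ≤ 3 + t`.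
      cover (copy i (suc x)) b = contradiction
        (ℕ.≤-trans (s≤s (ℕ.+-monoʳ-≤ 3 0<t)) 3+t<k) (ℕ.≤⇒≯ (bVertex⇒≤ (copy i (suc x)) b))

    edges-or-centres : 4 < k → k ≤ n + n
    edges-or-centres 4<k = colours≤range f cover
      where
      site : Fin n ⊎ Fin n → Graph.V G
      site = [ (λ i → rim (edgeFrom i)) , (λ i → copy i zero) ]′

      f : Fin (n + n) → Graph.V G
      f = site ∘ splitAt n

      cover : ∀ v → IsBVertex G color v → ∃ λ x → f x ≡ v
      cover (rim e) b = start e ↑ˡ n , trans (cong site (Fin.splitAt-↑ˡ n (start e) n))
        (cong (inj₁ ∘ inj₂) (start-injective (start-edgeFrom (start e))))
      cover (copy i zero) b = n ↑ʳ i , cong site (Fin.splitAt-↑ʳ n n i)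
      cover (hub i) b = contradiction
        (ℕ.<-trans (s<s (s<s (s<s z<s))) 4<k) (ℕ.≤⇒≯ (bVertex⇒≤ (hub i) b))
      cover (copy i (suc x)) b = contradiction 4<k (ℕ.≤⇒≯ (bVertex⇒≤ (copy i (suc x)) b))

  colours≤max-degree : ∀ {k} → BColoring G k → k ≤ suc ((2 + t) + (2 + t))
  colours≤max-degree {zero} β = z≤n
  colours≤max-degree {suc k} β =
    let (v , _ , b) = BColoring.bVertex β zero in ℕ.≤-trans (bVertex⇒≤ v b) (s≤s (degree≤ v))
    where
    degree≤ : ∀ v → degree v ≤ (2 + t) + (2 + t)
    degree≤ (hub i) = ℕ.m≤m+n 2 (t + (2 + t))
    degree≤ (rim e) = ℕ.≤-refl
    degree≤ (copy i zero) = ℕ.m≤m+n (2 + t) (2 + t)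
    degree≤ (copy i (suc x)) = ℕ.≤-trans (ℕ.m≤m+n 3 1) (ℕ.+-mono-≤ (ℕ.m≤m+n 2 t) (ℕ.m≤m+n 2 t))

  -- Colourings prescribed along the cycle

  -- Along the cycle, ε colours the edges by their starting points and κ i the
  -- vertices around i; index zero is i itself, index 1 the centre of its star.
  module Colouring {k} (ε : Fin n → Fin k) (κ : Fin n → Fin (2 + t) → Fin k)
    (κ≢ε : ∀ i q → κ i q ≢ ε i)
    (κ≢ε-prev : ∀ {i j} → Next i j → ∀ q → κ j q ≢ ε i)
    (centre≢leaf : ∀ i x → κ i (suc zero) ≢ κ i (suc (suc x)))
    where

    colour : Graph.V G → Fin k
    colour (hub i) = κ i zero
    colour (rim e) = ε (start e)
    colour (copy i h) = κ i (suc h)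

    colour-around : ∀ i q → colour (around i q) ≡ κ i q
    colour-around i zero = refl
    colour-around i (suc h) = refl

    around≢rim : ∀ {i} e → Incident {Cₙ} i e → ∀ q → κ i q ≢ ε (start e)
    around≢rim e inc q with incident⇒end e inc
    ... | inj₁ refl = κ≢ε _ q
    ... | inj₂ refl = κ≢ε-prev (next-ends e) q

    colour-proper : ∀ v w → Graph.Adj G v w → colour v ≢ colour w
    colour-proper (hub i) (rim e) inc = around≢rim e inc zero
    colour-proper (rim e) (hub i) inc = around≢rim e inc zero ∘ sym
    colour-proper (rim e) (copy i h) inc = around≢rim e inc (suc h) ∘ sym
    colour-proper (copy i h) (rim e) inc = around≢rim e inc (suc h)
    colour-proper (copy i zero) (copy .i (suc x)) (refl , _) = centre≢leaf i x
    colour-proper (copy i (suc x)) (copy .i zero) (refl , _) = centre≢leaf i x ∘ sym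

    coloring : (∀ j → ∃ λ v → colour v ≡ j × IsBVertex G colour v) → BColoring G k
    coloring b = record
      { color   = colour
      ; proper  = λ {v} {w} → colour-proper v w
      ; bVertex = b
      }

    -- The vertex inserted between `i` and `j` is joined to everything around `i` and around `j`, so
    -- the two families may share the work.
    rim-bVertex : ∀ {i j} → Next i j →
      (∀ a → a ≢ ε i → (∃ λ q → κ i q ≡ a) ⊎ (∃ λ q → κ j q ≡ a)) →
      IsBVertex G colour (rim (edgeFrom i))
    rim-bVertex {i} {j} i→j cover a a≢
      with cover a (λ eq → a≢ (trans eq (cong ε (sym (start-edgeFrom i)))))
    ... | inj₁ (q , eq) = around i q , rim-around (edgeFrom i) (incident-edgeFrom i) q ,
        trans (colour-around i q) eq
    ... | inj₂ (q , eq) = around j q , rim-around (edgeFrom i) j∈e q ,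
        trans (colour-around j q) eq
      where
      j∈e : Incident {Cₙ} j (edgeFrom i)
      j∈e = end⇒incident (edgeFrom i) (inj₂ (next-functional i→j
        (subst (λ h → Next h (finish (edgeFrom i))) (start-edgeFrom i) (next-ends (edgeFrom i)))))

    -- A centre sees its leaves and the two edges at `i`, coloured `ε i` and `ε (prev i)`.
    centre-bVertex : ∀ i →
      (∀ a → a ≢ κ i (suc zero) → a ≡ ε i ⊎ a ≡ ε (prev i) ⊎ (∃ λ x → κ i (suc (suc x)) ≡ a)) →
      IsBVertex G colour (copy i zero)
    centre-bVertex i cover a a≢ with cover a a≢
    ... | inj₁ refl = rim (edgeFrom i) , incident-edgeFrom i , cong ε (start-edgeFrom i)
    ... | inj₂ (inj₁ refl) = rim (edgeTo i) , incident-edgeTo i , cong ε (start-edgeFrom (prev i))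
    ... | inj₂ (inj₂ (x , eq)) = copy i (suc x) , (refl , _) , eq

  -- More colours than edges

  module DistinctEdges {m : ℕ} (n<k : n < 4 + m) (k≤2n : 4 + m ≤ n + n) (m<t : m < t) where

    edgeColour : Fin n → Fin (4 + m)
    edgeColour i = inject≤ i (ℕ.<⇒≤ n<k)

    -- Runs through the colours from `n` on and then repeats the last; by `k≤2n` the `n` centres
    -- reach all of them.
    centreColour : Fin n → Fin (4 + m)
    centreColour i = clamp (3 + m) (n + toℕ i)

    edgeColour<n : ∀ i → toℕ (edgeColour i) < n
    edgeColour<n i = subst (_< n) (sym (Fin.toℕ-inject≤ i _)) (Fin.toℕ<n i)

    n≤centreColour : ∀ i → n ≤ toℕ (centreColour i)
    n≤centreColour i = subst (n ≤_) (sym (toℕ-clamp (3 + m) _))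
      (ℕ.⊓-glb (ℕ.m≤m+n n (toℕ i)) (ℕ.≤-pred n<k))

    centre≢edge : ∀ i j → centreColour i ≢ edgeColour j
    centre≢edge i j eq =
      ℕ.<⇒≱ (edgeColour<n j) (subst (λ a → n ≤ toℕ a) eq (n≤centreColour i))

    edgeColour-injective : ∀ {i j} → edgeColour i ≡ edgeColour j → i ≡ j
    edgeColour-injective = Fin.inject≤-injective _ _ _ _

    edgeColour-onto : ∀ a → toℕ a < n → ∃ λ i → edgeColour i ≡ a
    edgeColour-onto a a<n = fromℕ< a<n ,
      Fin.toℕ-injective (trans (Fin.toℕ-inject≤ _ _) (Fin.toℕ-fromℕ< a<n))

    centreColour-onto : ∀ a → n ≤ toℕ a → ∃ λ i → centreColour i ≡ a
    centreColour-onto a n≤a = fromℕ< a∸n<n ,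
      trans (cong (clamp (3 + m)) (trans (cong (n +_) (Fin.toℕ-fromℕ< a∸n<n)) (ℕ.m+[n∸m]≡n n≤a)))
        (clamp-toℕ a)
      where
      a∸n<n : toℕ a ∸ n < n
      a∸n<n = ℕ.+-cancelˡ-< n _ _
        (subst (_< n + n) (sym (ℕ.m+[n∸m]≡n n≤a)) (ℕ.<-≤-trans (Fin.toℕ<n a) k≤2n))

    prev≢ : ∀ i → prev i ≢ i
    prev≢ i eq = next-irrefl (ℕ.<-trans (s<s z<s) 2<n) i (subst (λ h → Next h i) eq (next-prev i))

    -- The colours of the neighbours of a leaf. They are three distinct ones, which leaves `suc m`
    -- colours for the `t` leaves; `m < t` lets all of them occur.
    used : Fin n → Fin 3 → Fin (4 + m)
    used i zero = centreColour i
    used i (suc zero) = edgeColour i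
    used i (suc (suc zero)) = edgeColour (prev i)

    used-injective : ∀ i → Injective _≡_ _≡_ (used i)
    used-injective i {zero} {zero} _ = refl
    used-injective i {zero} {suc zero} eq = contradiction eq (centre≢edge i _)
    used-injective i {zero} {suc (suc zero)} eq = contradiction eq (centre≢edge i _)
    used-injective i {suc zero} {zero} eq = contradiction (sym eq) (centre≢edge i _)
    used-injective i {suc zero} {suc zero} _ = refl
    used-injective i {suc zero} {suc (suc zero)} eq =
      contradiction (sym (edgeColour-injective eq)) (prev≢ i)
    used-injective i {suc (suc zero)} {zero} eq = contradiction (sym eq) (centre≢edge i _)
    used-injective i {suc (suc zero)} {suc zero} eq =
      contradiction (edgeColour-injective eq) (prev≢ i)
    used-injective i {suc (suc zero)} {suc (suc zero)} _ = refl

    unused : ∀ i → ∃ λ (f : Fin (suc m) → Fin (4 + m)) →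
      (∀ x y → f x ≢ used i y) × (∀ a → (∀ y → a ≢ used i y) → ∃ λ x → f x ≡ a)
    unused i = complement 3 (used i) (used-injective i)

    leafColour : Fin n → Fin t → Fin (4 + m)
    leafColour i x = proj₁ (unused i) (clamp m (toℕ x))

    leaf≢used : ∀ i x y → leafColour i x ≢ used i y
    leaf≢used i x = proj₁ (proj₂ (unused i)) (clamp m (toℕ x))

    leafColour-onto : ∀ i a → (∀ y → a ≢ used i y) → ∃ λ x → leafColour i x ≡ a
    leafColour-onto i a a≢ with proj₂ (proj₂ (unused i)) a a≢
    ... | y , eq = inject≤ y m<t ,
      trans (cong (proj₁ (unused i)) (trans (cong (clamp m) (Fin.toℕ-inject≤ y m<t)) (clamp-toℕ y))) eq

    around-colour : Fin n → Fin (2 + t) → Fin (4 + m)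
    -- The vertex `i` is not adjacent to its star, so it may share the colour of the centre.
    around-colour i zero = centreColour i
    around-colour i (suc zero) = centreColour i
    around-colour i (suc (suc x)) = leafColour i x

    around≢edge : ∀ i q → around-colour i q ≢ edgeColour i
    around≢edge i zero = centre≢edge i i
    around≢edge i (suc zero) = centre≢edge i i
    around≢edge i (suc (suc x)) = leaf≢used i x (suc zero)

    around≢prev-edge : ∀ {i j} → Next i j → ∀ q → around-colour j q ≢ edgeColour i
    around≢prev-edge {i} {j} i→j q with next-injective i→j (next-prev j)
    around≢prev-edge {j = j} _ zero | refl = centre≢edge j _
    around≢prev-edge {j = j} _ (suc zero) | refl = centre≢edge j _
    around≢prev-edge {j = j} _ (suc (suc x)) | refl = leaf≢used j x (suc (suc zero))

    open Colouring edgeColour around-colour around≢edge around≢prev-edge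
      (λ i x → leaf≢used i x zero ∘ sym)

    centre-cover : ∀ i a → a ≢ centreColour i →
      a ≡ edgeColour i ⊎ a ≡ edgeColour (prev i) ⊎ (∃ λ x → leafColour i x ≡ a)
    centre-cover i a a≢ with Fin.any? (λ y → a Fin.≟ used i y)
    ... | yes (zero , eq) = contradiction eq a≢
    ... | yes (suc zero , eq) = inj₁ eq
    ... | yes (suc (suc zero) , eq) = inj₂ (inj₁ eq)
    ... | no ∄y = inj₂ (inj₂ (leafColour-onto i a λ y eq → ∄y (y , eq)))

    -- The star at i misses only the colour of the edge before i, which
    -- occurs in the star at j because n > 2.
    edge-cover : ∀ {i j} → Next i j → ∀ a → a ≢ edgeColour i →
      (∃ λ q → around-colour i q ≡ a) ⊎ (∃ λ q → around-colour j q ≡ a)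
    edge-cover {i} {j} i→j a a≢ with a Fin.≟ centreColour i
    ... | yes eq = inj₁ (zero , sym eq)
    ... | no a≢centre with centre-cover i a a≢centre
    ...   | inj₁ eq = contradiction eq a≢
    ...   | inj₂ (inj₂ (x , eq)) = inj₁ (suc (suc x) , eq)
    ...   | inj₂ (inj₁ refl) with leafColour-onto j a prev-unused
      where
      prev-unused : ∀ y → edgeColour (prev i) ≢ used j y
      prev-unused zero eq = centre≢edge j _ (sym eq)
      prev-unused (suc zero) eq = next-asym 2<n i→j
        (subst (λ h → Next h i) (edgeColour-injective eq) (next-prev i))
      prev-unused (suc (suc zero)) eq =
        prev≢ i (trans (edgeColour-injective eq) (next-injective (next-prev j) i→j))
    ...     | x , eq = inj₂ (suc (suc x) , eq)

    distinct-edges-coloring : BColoring G (4 + m)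
    distinct-edges-coloring = coloring bVertices
      where
      bVertices : ∀ a → ∃ λ v → colour v ≡ a × IsBVertex G colour v
      bVertices a with toℕ a ℕ.<? n
      -- Colours below `n` have their b-vertex on an edge, the others on a centre.
      ... | yes a<n with edgeColour-onto a a<n
      ...   | i , eq = rim (edgeFrom i) , trans (cong edgeColour (start-edgeFrom i)) eq ,
        rim-bVertex (proj₂ (successor i)) (edge-cover (proj₂ (successor i)))
      bVertices a | no a≮n with centreColour-onto a (ℕ.≮⇒≥ a≮n)
      ...   | i , eq = copy i zero , eq , centre-bVertex i (centre-cover i)

  -- At most as many colours as edges

  module RepeatedEdges {K : ℕ} (2<K : 2 < K) (K<n : K < n) (K≤ : K ≤ (2 + t) + (2 + t)) where

    -- Constant from `suc K` on instead of reduced modulo `suc K`: consecutive edges then have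
    -- consecutive or equal colours even where the cycle closes.
    wrap : Fin n → Fin (suc K)
    wrap i with toℕ i ℕ.<? suc K
    ... | yes i<k = fromℕ< i<k
    ... | no _ = zero

    wrap-< : ∀ i → toℕ i < suc K → toℕ (wrap i) ≡ toℕ i
    wrap-< i i<k with toℕ i ℕ.<? suc K
    ... | yes p = Fin.toℕ-fromℕ< p
    ... | no i≮k = contradiction i<k i≮k

    wrap-≥ : ∀ i → suc K ≤ toℕ i → wrap i ≡ zero
    wrap-≥ i k≤i with toℕ i ℕ.<? suc K
    ... | yes i<k = contradiction k≤i (ℕ.<⇒≱ i<k)
    ... | no _ = refl

    wrap-0 : ∀ i → toℕ i ≡ 0 → toℕ (wrap i) ≡ 0
    wrap-0 i eq = trans (wrap-< i (subst (_< suc K) (sym eq) z<s)) eq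

    -- Colour `K` is followed by 0 in two ways: the next index is `suc K`, which `wrap` sends to 0,
    -- or `n = suc K` and the cycle closes.
    wrap-next-< : ∀ {i j} → toℕ i < suc K → Next i j → Next (wrap i) (wrap j)
    wrap-next-< {i} {j} i<k (inj₁ p) with ℕ.m≤n⇒m<n∨m≡n i<k
    ... | inj₁ si<k = inj₁ (trans (wrap-< j (subst (_< suc K) (sym p) si<k))
      (trans p (cong suc (sym (wrap-< i i<k)))))
    ... | inj₂ si≡k = inj₂ (trans (cong suc (wrap-< i i<k)) si≡k ,
      cong toℕ (wrap-≥ j (ℕ.≤-reflexive (trans (sym si≡k) (sym p)))))
    wrap-next-< {i} {j} i<k (inj₂ (p , q)) = inj₂
      (trans (cong suc (wrap-< i i<k)) (ℕ.≤-antisym i<k (subst (suc K ≤_) (sym p) K<n)) , wrap-0 j q)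

    wrap-next : ∀ {i j} → Next i j → Next (wrap i) (wrap j) ⊎ wrap i ≡ wrap j
    wrap-next {i} {j} i→j with ℕ.<-≤-connex (toℕ i) (suc K)
    ... | inj₁ i<k = inj₁ (wrap-next-< i<k i→j)
    ... | inj₂ k≤i = inj₂ (trans (wrap-≥ i k≤i) (sym (wrap-j i→j)))
      where
      wrap-j : Next i j → wrap j ≡ zero
      wrap-j (inj₁ p) = wrap-≥ j (subst (suc K ≤_) (sym p) (ℕ.m≤n⇒m≤1+n k≤i))
      wrap-j (inj₂ (_ , q)) = Fin.toℕ-injective (wrap-0 j q)

    -- How far the colour of each vertex around `i` lies behind `wrap i`: `K` for `i` itself, and 2,
    -- 4, 6, ... capped at `K` along the star.
    step : Fin (2 + t) → ℕ
    step zero = K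
    step (suc x) = (suc (toℕ x) + suc (toℕ x)) ⊓ K

    step≤K : ∀ q → step q ≤ K
    step≤K zero = ℕ.≤-refl
    step≤K (suc x) = ℕ.m⊓n≤n _ K

    2≤step : ∀ q → 2 ≤ step q
    2≤step zero = ℕ.<⇒≤ 2<K
    2≤step (suc x) = ℕ.⊓-glb (ℕ.+-mono-≤ (s≤s z≤n) (s≤s z≤n)) (ℕ.<⇒≤ 2<K)

    -- The centre has offset 2; a leaf has at least 4 or is capped at `K`, and `2 < K`.
    step-1≢ : ∀ x → step (suc zero) ≢ step (suc (suc x))
    step-1≢ x = ℕ.<⇒≢ (ℕ.≤-<-trans (ℕ.m⊓n≤m 2 K)
      (ℕ.⊓-glb (ℕ.+-mono-≤ (s≤s (s≤s z≤n)) (s≤s z≤n)) 2<K))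

    -- The `1 + t` star vertices supply the even offsets below `K` because `K` is at most `2t + 4`;
    -- if `K` itself is even, index zero supplies it.
    step-onto : ∀ h → suc h + suc h ≤ K → ∃ λ q → step q ≡ suc h + suc h
    step-onto h 2h≤K with ℕ.m≤n⇒m<n∨m≡n 2h≤K
    ... | inj₂ eq = zero , sym eq
    ... | inj₁ 2h<K = suc (fromℕ< h<1+t) ,
      trans (cong (λ x → (suc x + suc x) ⊓ K) (Fin.toℕ-fromℕ< h<1+t)) (ℕ.m≤n⇒m⊓n≡m 2h≤K)
      where
      h<1+t : h < suc t
      h<1+t = ℕ.≰⇒> λ 1+t≤h →
        ℕ.<⇒≱ (ℕ.<-≤-trans 2h<K K≤) (ℕ.+-mono-≤ (s≤s 1+t≤h) (s≤s 1+t≤h))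

    back : ∀ q (a : Fin (suc K)) → ∃ (Back (step q) a)
    back q a = go-back (step≤K q) a

    around-colour : Fin n → Fin (2 + t) → Fin (suc K)
    around-colour i q = proj₁ (back q (wrap i))

    around-back : ∀ i q → Back (step q) (wrap i) (around-colour i q)
    around-back i q = proj₂ (back q (wrap i))

    around≢edge′ : ∀ i q {a} → a ≡ wrap i → around-colour i q ≢ a
    around≢edge′ i q refl eq = ℕ.<⇒≢ (ℕ.<-≤-trans z<s (2≤step q))
      (back-distance-unique z≤n (step≤K q) back-refl (subst (Back (step q) (wrap i)) eq (around-back i q)))

    -- Behind `wrap j`, the preceding edge lies at offset 1, or at 0 when both edges have colour 0;
    -- every `step` is at least 2.
    around≢prev-edge : ∀ {i j} → Next i j → ∀ q → around-colour j q ≢ wrap i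
    around≢prev-edge {i} {j} i→j q with wrap-next i→j
    ... | inj₂ eq = around≢edge′ j q eq
    ... | inj₁ a→b = λ eq → ℕ.<⇒≢ (2≤step q)
      (back-distance-unique (ℕ.≤-trans (s≤s z≤n) 2<K) (step≤K q)
        (back-next z≤n a→b back-refl) (subst (Back (step q) (wrap j)) eq (around-back j q)))

    centre≢leaf : ∀ i x → around-colour i (suc zero) ≢ around-colour i (suc (suc x))
    centre≢leaf i x eq = step-1≢ x (back-distance-unique (step≤K (suc zero)) (step≤K (suc (suc x)))
      (subst (Back (step (suc zero)) (wrap i)) eq (around-back i (suc zero))) (around-back i (suc (suc x))))

    open Colouring wrap around-colour (λ i q → around≢edge′ i q refl) around≢prev-edge centre≢leaf

    around-onto : ∀ i {a d} q → step q ≡ d → Back d (wrap i) a → ∃ λ q → around-colour i q ≡ a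
    around-onto i q refl b = q , back-target-unique (around-back i q) b

    edge-cover : ∀ i j → Next (wrap i) (wrap j) → ∀ a → a ≢ wrap i →
      (∃ λ q → around-colour i q ≡ a) ⊎ (∃ λ q → around-colour j q ≡ a)
    edge-cover i j i→j a a≢ with distance (a≢ ∘ sym)
    ... | d , 0<d , d≤K , b with halve d
    ...   | zero , inj₁ refl = contradiction 0<d (ℕ.<-irrefl refl)
    ...   | suc h , inj₁ refl with step-onto h d≤K
    ...     | q , eq = inj₁ (around-onto i q eq b)
    edge-cover i j i→j a a≢ | d , 0<d , d≤K , b | h , inj₂ refl with ℕ.m≤n⇒m<n∨m≡n d≤K
    ...     | inj₂ eq = inj₁ (around-onto i zero (sym eq) b)
    -- Seen from `wrap j`, the odd distance `d` becomes the even `suc d`, which `d < K` keeps within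
    -- `K`.
    ...     | inj₁ d<K with step-onto h (subst (_≤ K) (cong suc (sym (ℕ.+-suc h h))) d<K)
    ...       | q , eq = inj₂ (around-onto j q (trans eq (cong suc (ℕ.+-suc h h)))
                (back-next d≤K i→j b))

    repeated-edges-coloring : BColoring G (suc K)
    -- The edge of index `a` serves colour `a`: being among the first `suc K`, it is followed by an
    -- edge of the cyclically next colour.
    repeated-edges-coloring = coloring λ a → rim (edgeFrom (inj a)) ,
      trans (cong wrap (start-edgeFrom (inj a))) (wrap-inj a) ,
      rim-bVertex (proj₂ (successor (inj a)))
        (edge-cover (inj a) (proj₁ (successor (inj a))) (wrap-next-< (inj<k a) (proj₂ (successor (inj a)))))
      where
      inj : Fin (suc K) → Fin n
      inj a = inject≤ a K<n

      inj<k : ∀ a → toℕ (inj a) < suc K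
      inj<k a = subst (_< suc K) (sym (Fin.toℕ-inject≤ a K<n)) (Fin.toℕ<n a)

      wrap-inj : ∀ a → wrap (inj a) ≡ a
      wrap-inj a = Fin.toℕ-injective (trans (wrap-< (inj a) (inj<k a)) (Fin.toℕ-inject≤ a K<n))

  -- The four values

  distinct-coloring : ∀ {k} → 4 ≤ k → n < k → k ≤ n + n → k ≤ 3 + t → BColoring G k
  distinct-coloring (s≤s (s≤s (s≤s (s≤s z≤n)))) n<k k≤2n (s≤s (s≤s (s≤s m<t))) =
    DistinctEdges.distinct-edges-coloring n<k k≤2n m<t

  repeated-coloring : ∀ {k} → 4 ≤ k → k ≤ n → k ≤ suc ((2 + t) + (2 + t)) → BColoring G k
  repeated-coloring (s≤s 2<K) K<n (s≤s K≤) = RepeatedEdges.repeated-edges-coloring 2<K K<n K≤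

  φ-2n : 2 * n ≤ 3 + t → φ G ≔ 2 * n
  φ-2n 2n≤3+t = subst (φ G ≔_) (cong (n +_) (sym (ℕ.+-identityʳ n)))
    ( distinct-coloring 4≤2n (ℕ.m<m+n n (ℕ.<-trans z<s 2<n)) ℕ.≤-refl
        (subst (_≤ 3 + t) (cong (n +_) (ℕ.+-identityʳ n)) 2n≤3+t)
    , bound)
    where
    4≤2n : 4 ≤ n + n
    4≤2n = ℕ.+-mono-≤ (ℕ.<⇒≤ 2<n) (ℕ.<⇒≤ 2<n)

    bound : ∀ k → BColoring G k → k ≤ n + n
    -- Up to 4 colours leaves could be b-vertices, but then `4 ≤ n + n` suffices.
    bound k β with ℕ.≤-<-connex k 4
    ... | inj₁ k≤4 = ℕ.≤-trans k≤4 4≤2n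
    ... | inj₂ 4<k = edges-or-centres β 4<k

  -- With more than `3 + t` colours, `edges-only` would give more than `3 + t` edges.
  φ-t+3 : 0 < t → 3 + t ≤ 2 * n → n < 3 + t → φ G ≔ 3 + t
  φ-t+3 0<t 3+t≤2n n<3+t =
    distinct-coloring (ℕ.+-monoʳ-≤ 3 0<t) n<3+t
      (subst (3 + t ≤_) (cong (n +_) (ℕ.+-identityʳ n)) 3+t≤2n) ℕ.≤-refl , bound
    where
    bound : ∀ k → BColoring G k → k ≤ 3 + t
    bound k β = ℕ.≮⇒≥ λ 3+t<k →
      ℕ.<⇒≱ (ℕ.<-trans n<3+t 3+t<k) (edges-only β 0<t 3+t<k)

  φ-n : 0 < t → 3 + t ≤ n → n ≤ suc ((2 + t) + (2 + t)) → φ G ≔ n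
  φ-n 0<t 3+t≤n n≤ =
    repeated-coloring (ℕ.≤-trans (ℕ.+-monoʳ-≤ 3 0<t) 3+t≤n) ℕ.≤-refl n≤ , bound
    where
    bound : ∀ k → BColoring G k → k ≤ n
    bound k β with ℕ.≤-<-connex k (3 + t)
    ... | inj₁ k≤3+t = ℕ.≤-trans k≤3+t 3+t≤n
    ... | inj₂ 3+t<k = edges-only β 0<t 3+t<k

  φ-2t+5 : suc ((2 + t) + (2 + t)) ≤ n → φ G ≔ suc ((2 + t) + (2 + t))
  φ-2t+5 ≤n = repeated-coloring (ℕ.+-mono-≤ (ℕ.m≤m+n 3 t) (ℕ.m≤m+n 1 (1 + t))) ≤n ℕ.≤-refl ,
    λ _ → colours≤max-degree

-- Translating the Boolean case distinction

if-cases : ∀ (P : ℕ → Set) b {x y} → (T b → P x) → (¬ T b → P y) → P (if b then x else y)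
if-cases P true p q = p _
if-cases P false p q = q λ ()

n≤⌊m/2⌋⇒2n≤m : ∀ {n} m → n ≤ ⌊ m /2⌋ → 2 * n ≤ m
n≤⌊m/2⌋⇒2n≤m {n} m n≤ = begin
  2 * n                   ≡⟨ cong (n +_) (ℕ.+-identityʳ n) ⟩
  n + n                   ≤⟨ ℕ.+-mono-≤ n≤ (ℕ.≤-trans n≤ (ℕ.⌊n/2⌋≤⌈n/2⌉ m)) ⟩
  ⌊ m /2⌋ + ⌈ m /2⌉       ≡⟨ ℕ.⌊n/2⌋+⌈n/2⌉≡n m ⟩
  m                       ∎
  where open ℕ.≤-Reasoning

⌊m/2⌋<n⇒m<2n : ∀ {m} n → ⌊ m /2⌋ < n → m < 2 * n
⌊m/2⌋<n⇒m<2n {m} n <n = ℕ.≰⇒> λ 2n≤m → ℕ.<⇒≱ <n (begin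
  n                  ≡⟨ ℕ.n≡⌊n+n/2⌋ n ⟩
  ⌊ n + n /2⌋        ≡⟨ cong (λ x → ⌊ n + x /2⌋) (ℕ.+-identityʳ n) ⟨
  ⌊ 2 * n /2⌋        ≤⟨ ℕ.⌊n/2⌋-mono 2n≤m ⟩
  ⌊ m /2⌋            ∎)
  where open ℕ.≤-Reasoning

theorem13 : (n t : ℕ) (2<n : 2 < n) → 2 < t →
    φ (C n 2<n ⊡ S t) ≔
    (if n ≤ᵇ ⌊ t + 3 /2⌋ then 2 * n
    else if (⌊ t + 3 /2⌋ <ᵇ n) ∧ (n ≤ᵇ t + 2) then t + 3
    else if (t + 3 ≤ᵇ n) ∧ (n ≤ᵇ 2 * t + 4) then n
    else 2 * t + 5)
theorem13 n t 2<n 2<t =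
  if-cases (φ G ≔_) (n ≤ᵇ ⌊ t + 3 /2⌋)
    (λ n≤h → φ-2n (subst (2 * n ≤_) t+3≡ (n≤⌊m/2⌋⇒2n≤m (t + 3) (ℕ.≤ᵇ⇒≤ n _ n≤h)))) λ n≰h →
  let h<n = ℕ.≰⇒> (n≰h ∘ ℕ.≤⇒≤ᵇ) in
  if-cases (φ G ≔_) ((⌊ t + 3 /2⌋ <ᵇ n) ∧ (n ≤ᵇ t + 2))
    (λ n≤t+2 → subst (φ G ≔_) (sym t+3≡)
      (φ-t+3 0<t (subst (_≤ 2 * n) t+3≡ (ℕ.<⇒≤ (⌊m/2⌋<n⇒m<2n n h<n)))
        (s≤s (subst (n ≤_) (ℕ.+-comm t 2) (ℕ.≤ᵇ⇒≤ n _ (proj₂ (to-∧ n≤t+2))))))) λ n≰t+2 →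
  -- The first conjunct is already known, so the failed conjunction refutes the second.
  let t+2<n = ℕ.≰⇒> λ n≤t+2 → n≰t+2 (from-∧ (ℕ.<⇒<ᵇ h<n , ℕ.≤⇒≤ᵇ n≤t+2))
      3+t≤n = subst (_< n) (ℕ.+-comm t 2) t+2<n in
  if-cases (φ G ≔_) ((t + 3 ≤ᵇ n) ∧ (n ≤ᵇ 2 * t + 4))
    (λ n≤2t+4 → φ-n 0<t 3+t≤n
      -- `φ-n` reaches up to `n = 2t + 5`, where the last two formulas agree; hence the weakening by
      -- one.
      (ℕ.m≤n⇒m≤1+n (subst (n ≤_) 2t+4≡ (ℕ.≤ᵇ⇒≤ n _ (proj₂ (to-∧ n≤2t+4)))))) λ n≰2t+4 →
  subst (φ G ≔_) 1+≡2t+5 (φ-2t+5 (subst (_< n) 2t+4≡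
    (ℕ.≰⇒> λ n≤2t+4 → n≰2t+4
      (from-∧ (ℕ.≤⇒≤ᵇ (subst (_≤ n) (sym t+3≡) 3+t≤n) , ℕ.≤⇒≤ᵇ n≤2t+4)))))
  where
  open Corona t 2<n

  0<t : 0 < t
  0<t = ℕ.<-trans z<s 2<t

  t+3≡ : t + 3 ≡ 3 + t
  t+3≡ = ℕ.+-comm t 3

  2t+4≡ : 2 * t + 4 ≡ (2 + t) + (2 + t)
  2t+4≡ = solve 1 (λ t → con 2 :* t :+ con 4 := (con 2 :+ t) :+ (con 2 :+ t)) refl t

  1+≡2t+5 : suc ((2 + t) + (2 + t)) ≡ 2 * t + 5
  1+≡2t+5 = trans (cong suc (sym 2t+4≡)) (sym (ℕ.+-suc (2 * t) 4))

  to-∧ : ∀ {x y} → T (x ∧ y) → T x × T y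
  to-∧ = Equivalence.to Bool.T-∧

  from-∧ : ∀ {x y} → T x × T y → T (x ∧ y)
  from-∧ {x} = Equivalence.from (Bool.T-∧ {x})
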